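{- Every type derivation $\pi$ of a judgment of the form $\Lambda\vdash t:L$, with $\Lambda$ a ground context and $L$ a ground type, is well-formed.
   Context: **Terms.** Terms $t,u$ and values $v,w$ (up to $\alpha$-equivalence): $t,u ::= v \mid \mathsf{sample}_d \mid \mathsf{case}\ v\ \mathsf{of}\ \{v_i\Rightarrow \mathsf{sample}_{d_i}\} \mid \mathsf{obs}(x=b) \mid \mathsf{let}\ x=u\ \mathsf{in}\ t \mid \mathsf{letp}\ \langle x,y\rangle=v\ \mathsf{in}\ t \mid t\,v\mid \lambda x.t\mid \mathsf{der}\,v$; $v,w ::= x \mid \langle v,w\rangle \mid\ !t \mid b$; $b::=\mathtt t\mid\mathtt f$; $d$ ranges over probability distributions on $\{\mathtt t,\mathtt f\}$. $\mathsf c\langle y_1,\dots,y_n\rangle$ abbreviates $\mathsf{case}\ \langle y_1,\dots,y_n\rangle\ \mathsf{of}\ \{\bar b\Rightarrow\mathsf{sample}_{d_{\bar b}}\}_{\bar b\in\{\mathtt t,\mathtt f\}^n}$. **Intersection types.** Fix a countable set of names $X,Y,Z,\dots$. Ground types $K,L::=X\mid K\otimes L$; positive types $P,Q::=L\mid[A_1,\dots,A_n]$ (finite multiset, $n\ge0$); types $A,B::=P\mid P\multimap A$. A typing context is a total map from variables to positive types with all but finitely many variables mapped to $[]$; it splits into its ground part $\Lambda$ (variables mapped to ground types) and its multiset part $\Gamma$; $\uplus$ is (pointwise) multiset union. $\mathrm{Nm}(\cdot)$ is the set of names occurring in a type, context, judgment or derivation. Rules (premises $\Longrightarrow$ conclusion):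 - (i-sample) $\Lambda\vdash\mathsf{sample}_d:X$ if $X\notin\mathrm{Nm}(\Lambda)$. - (i-cond) $\Lambda,y_1:Y_1,\dots,y_n:Y_n\vdash\mathsf c\langle y_1,\dots,y_n\rangle:X$ if $X\notin\{Y_1,\dots,Y_n\}$ and $X\notin\mathrm{Nm}(\Lambda)$. - (i-var) $\Lambda,x:P\vdash x:P$. - (i-let) $\Lambda,\Gamma_1\vdash u:P$ and $\Lambda,\Gamma_2,x:P\vdash t:A$ $\Longrightarrow$ $\Lambda,\Gamma_1\uplus\Gamma_2\vdash\mathsf{let}\ x=u\ \mathsf{in}\ t:A$. - (i-pair) $\Lambda\vdash v:L_1$ and $\Lambda\vdash w:L_2$ $\Longrightarrow$ $\Lambda\vdash\langle v,w\rangle:L_1\otimes L_2$. - (i-letp) $\Lambda\vdash v:L_1\otimes L_2$ and $\Lambda,x:L_1,y:L_2,\Gamma\vdash t:A$ $\Longrightarrow$ $\Lambda,\Gamma\vdash\mathsf{letp}\ \langle x,y\rangle=v\ \mathsf{in}\ t:A$. - (i-abs) $\Lambda,\Gamma,x:P\vdash t:A$ $\Longrightarrow$ $\Lambda,\Gamma\vdash\lambda x.t:P\multimap A$. - (i-app) $\Lambda,\Gamma_1\vdash t:P\multimap A$ and $\Lambda,\Gamma_2\vdash v:P$ $\Longrightarrow$ $\Lambda,\Gamma_1\uplus\Gamma_2\vdash t\,v:A$. - (i-bang) $(\Lambda,\Gamma_i\vdash t:A_i)_{i=1}^n$, $n\ge0$ $\Longrightarrow$ $\Lambda,\biguplus_i\Gamma_i\vdash\,!t:[A_1,\dots,A_n]$.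 - (i-der) $\Lambda,\Gamma\vdash v:[A]$ $\Longrightarrow$ $\Lambda,\Gamma\vdash\mathsf{der}\,v:A$. The name $X$ typing the subject of an (i-sample) or (i-cond) axiom is its *main name*. Naming condition (part of the definition of a derivation): the main names of a derivation are pairwise distinct. **Well-formedness.** Derivations $\pi_1,\dots,\pi_n$ of $J_1,\dots,J_n$ are *compatible* if for every name $Z$ and every $j$: if $Z\in\mathrm{Nm}(\pi_j)$ and $Z\notin\mathrm{Nm}(J_j)$, then $Z\notin\mathrm{Nm}(\pi_i)$ for all $i\ne j$. A derivation $\pi$ is *well-formed* if for every rule in $\pi$, the derivations of its premises are compatible. -}

module Defs where

open import Algebra.Bundles using (CommutativeRing)
open import Data.Bool.Base using (Bool; true; false)
open import Data.Fin.Base using (Fin)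
open import Data.List.Base as List using (List; []; _∷_; _++_; concat; concatMap)
open import Data.List.Membership.Propositional using (_∈_; _∉_)
open import Data.List.Relation.Binary.Permutation.Homogeneous using (Permutation)
open import Data.List.Relation.Binary.Permutation.Propositional using (_↭_)
open import Data.List.Relation.Unary.All using () renaming (All to Allᴸ)
open import Data.List.Relation.Unary.Unique.Propositional using (Unique)
open import Data.Nat.Base using (ℕ; zero; suc)
open import Data.Product.Base using (∃; _×_; _,_; proj₁; proj₂)
open import Data.Vec.Base as Vec using (Vec; []; _∷_; lookup; toList)
open import Data.Vec.Relation.Unary.All using (All)
open import Level using (Level; _⊔_) renaming (suc to lsuc)
open import Relation.Binary.Core using (Rel)
open import Relation.Binary.PropositionalEquality.Core using (_≡_; _≢_)
open import Relation.Binary.Structures using (IsPartialOrder)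

-- The library has no real numbers.  Probabilities take values in an arbitrary
-- partially ordered commutative ring, of which ℝ is an instance.
record OrderedRing c ℓ₁ ℓ₂ : Set (lsuc (c ⊔ ℓ₁ ⊔ ℓ₂)) where
  field
    commutativeRing : CommutativeRing c ℓ₁
  open CommutativeRing commutativeRing public
  infix 4 _≤_
  field
    _≤_            : Rel Carrier ℓ₂
    isPartialOrder : IsPartialOrder _≈_ _≤_
    +-mono-≤       : ∀ {x y u v} → x ≤ y → u ≤ v → x + u ≤ y + v
    *-nonNegative  : ∀ {x y} → 0# ≤ x → 0# ≤ y → 0# ≤ x * y

Name : Set
Name = ℕ

infixr 7 _⊗_
infixr 6 _⊸_

data Ground : Set where
  name : Name → Ground
  _⊗_  : Ground → Ground → Ground

data Ty : Set

-- Multisets are represented by lists; equality of types is _≅_ below.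
data Pos : Set where
  gnd  : Ground → Pos
  mset : List Ty → Pos

data Ty where
  pos : Pos → Ty
  _⊸_ : Pos → Ty → Ty

-- Equality of types: reordering of multisets at any depth.
infix 4 _≅_ _≅ᵖ_

data _≅_ : Ty → Ty → Set

data _≅ᵖ_ : Pos → Pos → Set where
  gnd  : ∀ {L} → gnd L ≅ᵖ gnd L
  mset : ∀ {As Bs} → Permutation _≅_ As Bs → mset As ≅ᵖ mset Bs

data _≅_ where
  pos : ∀ {P Q} → P ≅ᵖ Q → pos P ≅ pos Q
  _⊸_ : ∀ {P Q A B} → P ≅ᵖ Q → A ≅ B → P ⊸ A ≅ Q ⊸ B

nmGround : Ground → List Name
nmGround (name X) = X ∷ []
nmGround (K ⊗ L)  = nmGround K ++ nmGround L

nmTy  : Ty → List Name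
nmTys : List Ty → List Name

nmPos : Pos → List Name
nmPos (gnd L)   = nmGround L
nmPos (mset As) = nmTys As

nmTy (pos P) = nmPos P
nmTy (P ⊸ A) = nmPos P ++ nmTy A

nmTys []       = []
nmTys (A ∷ As) = nmTy A ++ nmTys As

-- A typing context with all variables outside the scope Fin m mapped to
-- mset [].  Its ground part and its multiset part are kept together.
Ctx : ℕ → Set
Ctx m = Vec Pos m

nmCtx : ∀ {m} → Ctx m → List Name
nmCtx Θ = concatMap nmPos (toList Θ)

data GroundOrEmpty : Pos → Set where
  gnd   : ∀ {L} → GroundOrEmpty (gnd L)
  empty : GroundOrEmpty (mset [])

IsGround : ∀ {m} → Ctx m → Set
IsGround = All GroundOrEmpty

groundPartᵖ : Pos → Pos
groundPartᵖ (gnd L)  = gnd L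
groundPartᵖ (mset _) = mset []

groundPart : ∀ {m} → Ctx m → Ctx m
groundPart = Vec.map groundPartᵖ

-- Θ ≅⨄ (Θ₁ ∷ … ∷ Θₙ ∷ []) holds when Θ and all the Θᵢ have the same ground
-- part Λ and the multiset part of Θ is the union of those of the Θᵢ.
infix 4 _≅⨄ᵖ_ _≅⨄_

data _≅⨄ᵖ_ {n} : Pos → Vec Pos n → Set where
  gnd  : ∀ {L Ps} → All (_≡ gnd L) Ps → gnd L ≅⨄ᵖ Ps
  mset : ∀ {As Ps} (Ass : Vec (List Ty) n) → Ps ≡ Vec.map mset Ass →
         Permutation _≅_ As (concat (toList Ass)) → mset As ≅⨄ᵖ Ps

_≅⨄_ : ∀ {m n} → Ctx m → Vec (Ctx m) n → Set
Θ ≅⨄ Θs = ∀ x → lookup Θ x ≅⨄ᵖ Vec.map (λ Θ′ → lookup Θ′ x) Θs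

allBools : ∀ n → List (Vec Bool n)
allBools zero    = [] ∷ []
allBools (suc n) = List.map (true ∷_) (allBools n) ++ List.map (false ∷_) (allBools n)

module Calculus {c ℓ₁ ℓ₂} (R : OrderedRing c ℓ₁ ℓ₂) where

  open OrderedRing R using (Carrier; _≈_; _≤_; _+_; 0#; 1#)

  record Dist : Set (c ⊔ ℓ₁ ⊔ ℓ₂) where
    field
      prob        : Bool → Carrier
      nonNegative : ∀ b → 0# ≤ prob b
      total       : prob true + prob false ≈ 1#

  -- Terms up to α-equivalence: de Bruijn indices over m free variables.
  data Tm (m : ℕ) : Set (c ⊔ ℓ₁ ⊔ ℓ₂)

  data Val (m : ℕ) : Set (c ⊔ ℓ₁ ⊔ ℓ₂) where
    var  : Fin m → Val m
    pair : Val m → Val m → Val m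
    bang : Tm m → Val m
    bool : Bool → Val m

  data Tm m where
    val    : Val m → Tm m
    sample : Dist → Tm m
    case   : Val m → List (Val m × Dist) → Tm m
    obs    : Fin m → Bool → Tm m
    lett   : Tm m → Tm (suc m) → Tm m
    letp   : Val m → Tm (suc (suc m)) → Tm m
    app    : Tm m → Val m → Tm m
    lam    : Tm (suc m) → Tm m
    der    : Val m → Tm m

  -- n-tuples, n ≥ 1, as right-nested pairs.
  tuple : ∀ {m n} → Vec (Val m) (suc n) → Val m
  tuple (v ∷ [])     = v
  tuple (v ∷ w ∷ vs) = pair v (tuple (w ∷ vs))

  branches : ∀ {m n} → (Vec Bool (suc n) → Dist) → List (Val m × Dist)
  branches d = List.map (λ b → tuple (Vec.map bool b) , d b) (allBools _)

  infix 3 _⊢_∶_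

  record Judgment : Set (c ⊔ ℓ₁ ⊔ ℓ₂) where
    constructor _⊢_∶_
    field
      {scope} : ℕ
      context : Ctx scope
      subject : Tm scope
      type    : Ty

  nmJudgment : Judgment → List Name
  nmJudgment (Θ ⊢ _ ∶ A) = nmCtx Θ ++ nmTy A

  -- Derivation trees, without the naming condition.  As multisets are lists,
  -- i-var and _≅⨄_ work up to _≅_; this suffices for derivability to be closed
  -- under _≅_ on types and contexts (in i-bang, by reordering the premises).
  data Tree : Judgment → Set (c ⊔ ℓ₁ ⊔ ℓ₂) where

    i-sample : ∀ {m} {Λ : Ctx m} {d X} →
      IsGround Λ → X ∉ nmCtx Λ →
      Tree (Λ ⊢ sample d ∶ pos (gnd (name X)))

    -- Λ includes the variables ys, so X ∉ nmCtx Λ covers both side conditions.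
    -- The branches of a case form a set, hence are listed in any order.
    i-cond : ∀ {m n} {Λ : Ctx m} (ys : Vec (Fin m) (suc n)) (Ys : Vec Name (suc n))
      (d : Vec Bool (suc n) → Dist) {brs X} →
      IsGround Λ → (∀ i → lookup Λ (lookup ys i) ≡ gnd (name (lookup Ys i))) →
      brs ↭ branches d → X ∉ nmCtx Λ →
      Tree (Λ ⊢ case (tuple (Vec.map var ys)) brs ∶ pos (gnd (name X)))

    i-var : ∀ {m} {Θ : Ctx m} {x P} →
      (∀ y → y ≢ x → GroundOrEmpty (lookup Θ y)) → lookup Θ x ≅ᵖ P →
      Tree (Θ ⊢ val (var x) ∶ pos P)

    i-let : ∀ {m} {Θ Θ₁ Θ₂ : Ctx m} {u t P A} →
      Θ ≅⨄ (Θ₁ ∷ Θ₂ ∷ []) →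
      Tree (Θ₁ ⊢ u ∶ pos P) → Tree (P ∷ Θ₂ ⊢ t ∶ A) →
      Tree (Θ ⊢ lett u t ∶ A)

    i-pair : ∀ {m} {Λ : Ctx m} {v w L₁ L₂} →
      IsGround Λ →
      Tree (Λ ⊢ val v ∶ pos (gnd L₁)) → Tree (Λ ⊢ val w ∶ pos (gnd L₂)) →
      Tree (Λ ⊢ val (pair v w) ∶ pos (gnd (L₁ ⊗ L₂)))

    i-letp : ∀ {m} {Θ : Ctx m} {v t L₁ L₂ A} →
      Tree (groundPart Θ ⊢ val v ∶ pos (gnd (L₁ ⊗ L₂))) →
      Tree (gnd L₂ ∷ gnd L₁ ∷ Θ ⊢ t ∶ A) →
      Tree (Θ ⊢ letp v t ∶ A)

    i-abs : ∀ {m} {Θ : Ctx m} {t P A} →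
      Tree (P ∷ Θ ⊢ t ∶ A) →
      Tree (Θ ⊢ lam t ∶ P ⊸ A)

    i-app : ∀ {m} {Θ Θ₁ Θ₂ : Ctx m} {t v P A} →
      Θ ≅⨄ (Θ₁ ∷ Θ₂ ∷ []) →
      Tree (Θ₁ ⊢ t ∶ P ⊸ A) → Tree (Θ₂ ⊢ val v ∶ pos P) →
      Tree (Θ ⊢ app t v ∶ A)

    i-bang : ∀ {m n} {Θ : Ctx m} {t} (Θs : Vec (Ctx m) n) (As : Vec Ty n) →
      Θ ≅⨄ Θs →
      (∀ i → Tree (lookup Θs i ⊢ t ∶ lookup As i)) →
      Tree (Θ ⊢ val (bang t) ∶ pos (mset (toList As)))

    i-der : ∀ {m} {Θ : Ctx m} {v A} →
      Tree (Θ ⊢ val v ∶ pos (mset (A ∷ []))) →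
      Tree (Θ ⊢ der v ∶ A)

  premises : ∀ {J} → Tree J → List (∃ Tree)
  premises (i-sample _ _)         = []
  premises (i-cond _ _ _ _ _ _ _) = []
  premises (i-var _ _)            = []
  premises (i-let _ π ρ)          = (_ , π) ∷ (_ , ρ) ∷ []
  premises (i-pair _ π ρ)         = (_ , π) ∷ (_ , ρ) ∷ []
  premises (i-letp π ρ)           = (_ , π) ∷ (_ , ρ) ∷ []
  premises (i-abs π)              = (_ , π) ∷ []
  premises (i-app _ π ρ)          = (_ , π) ∷ (_ , ρ) ∷ []
  premises (i-bang _ _ _ πs)      = List.tabulate (λ i → _ , πs i)
  premises (i-der π)              = (_ , π) ∷ []

  -- Concatenates f over all nodes of a tree.
  collect collectPremises : (∀ {J} → Tree J → List Name) → ∀ {J} → Tree J → List Name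
  collect f π = f π ++ collectPremises f π

  collectPremises f (i-sample _ _)         = []
  collectPremises f (i-cond _ _ _ _ _ _ _) = []
  collectPremises f (i-var _ _)            = []
  collectPremises f (i-let _ π ρ)          = collect f π ++ collect f ρ
  collectPremises f (i-pair _ π ρ)         = collect f π ++ collect f ρ
  collectPremises f (i-letp π ρ)           = collect f π ++ collect f ρ
  collectPremises f (i-abs π)              = collect f π
  collectPremises f (i-app _ π ρ)          = collect f π ++ collect f ρ
  collectPremises f (i-bang _ _ _ πs)      = concat (List.tabulate (λ i → collect f (πs i)))
  collectPremises f (i-der π)              = collect f π

  nmTree : ∀ {J} → Tree J → List Name
  nmTree = collect λ {J} _ → nmJudgment J

  mainName : ∀ {J} → Tree J → List Name
  mainName (i-sample {X = X} _ _)         = X ∷ []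
  mainName (i-cond _ _ _ {X = X} _ _ _ _) = X ∷ []
  mainName _                              = []

  mainNames : ∀ {J} → Tree J → List Name
  mainNames = collect mainName

  record Derivation (J : Judgment) : Set (c ⊔ ℓ₁ ⊔ ℓ₂) where
    field
      tree   : Tree J
      naming : Unique (mainNames tree)

  Compatible : List (∃ Tree) → Set
  Compatible πs = ∀ Z j →
    Z ∈ nmTree (proj₂ (List.lookup πs j)) → Z ∉ nmJudgment (proj₁ (List.lookup πs j)) →
    ∀ i → i ≢ j → Z ∉ nmTree (proj₂ (List.lookup πs i))

  data WellFormedTree : ∃ Tree → Set (c ⊔ ℓ₁ ⊔ ℓ₂) where
    wf : ∀ {J} {π : Tree J} → Compatible (premises π) →
         Allᴸ WellFormedTree (premises π) → WellFormedTree (J , π)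

  WellFormed : ∀ {J} → Derivation J → Set (c ⊔ ℓ₁ ⊔ ℓ₂)
  WellFormed π = WellFormedTree (_ , Derivation.tree π)

{-# OPTIONS --safe #-}

-- Fix a name Z and interpret types in the three-element Sugihara monoid
-- ⊖ < ⊙ < ⊕: the name Z is ⊖, all other names are ⊙, tensors, multisets and
-- contexts are products, and ⊸ is the residual of the product.  A type is ⊙
-- exactly when Z does not occur in it.  If Z is not a main name, all typing rules
-- are sound: ⟦ Θ ⟧ ≤ ⟦ A ⟧ for Θ ⊢ t ∶ A, and even ⊕ ∙ ⟦ Θ ⟧ ≤ ⟦ A ⟧ when Z occurs
-- somewhere in the derivation.  The latter inequality fails if Z does not occur in
-- Θ and A, so a name that occurs in a derivation but not in its conclusion is a
-- main name of it.
--
-- Now let Z violate compatibility: it is a main name of one premise, does not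
-- occur in the judgment of that premise, but occurs in another premise.  By the
-- uniqueness of main names Z is not a main name elsewhere, and the first judgment
-- satisfies ⟦ Θ ⟧ ≤ ⟦ A ⟧ since both sides are ⊙.  So soundness still yields
-- ⊕ ∙ ⟦ Λ ⟧ ≤ ⟦ L ⟧ ≤ ⊙ for the conclusion of the whole derivation.  But ⟦ Λ ⟧ = ⊙,
-- because a name in Λ would occur in the judgment of every premise.
module Submission where

open import Defs

open import Algebra.Bundles using (IdempotentCommutativeMonoid)
open import Algebra.Definitions using (Associative; Commutative; Idempotent)
import Algebra.Properties.CommutativeMonoid.Sum as Sum
import Algebra.Solver.IdempotentCommutativeMonoid as Solver
open import Data.Empty using (⊥-elim)
open import Data.Fin.Base using (Fin; zero; suc)
open import Data.Fin.Properties using (suc-injective) renaming (_≟_ to _≟ᶠ_)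
open import Data.List.Base as List using (List; []; _∷_; _++_; concat; concatMap; length)
import Data.List.Membership.DecPropositional as Membership
open import Data.List.Membership.Propositional using (_∈_; _∉_)
open import Data.List.Membership.Propositional.Properties
  using (∈-++⁺ˡ; ∈-++⁺ʳ; ∈-++⁻; ∈-lookup; ∈-tabulate⁻; ∈-concatMap⁻)
open import Data.List.Properties using (++-identityʳ; map-tabulate)
open import Data.List.Relation.Binary.Disjoint.Propositional using (Disjoint)
open import Data.List.Relation.Binary.Permutation.Homogeneous
  using (Permutation; refl; prep; swap; trans)
open import Data.List.Relation.Binary.Pointwise.Base using (Pointwise; []; _∷_)
open import Data.List.Relation.Unary.All using ()
  renaming (lookup to lookupᴬ; All to Allᴸ; [] to []ᴸ; _∷_ to _∷ᴸ_)
import Data.List.Relation.Unary.All.Properties as Allᴸ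
open import Data.List.Relation.Unary.AllPairs using ([]; _∷_)
open import Data.List.Relation.Unary.Any using (here; there; index)
open import Data.List.Relation.Unary.Any.Properties using (lookup-index)
open import Data.List.Relation.Unary.Unique.Propositional using (Unique)
open import Data.Nat.Base using (zero; suc)
open import Data.Nat.Properties using (_≟_)
open import Data.Product.Base using (∃; _×_; _,_; proj₁; proj₂)
open import Data.Sum.Base using (_⊎_; [_,_]; map₂)
open import Data.Vec.Base as Vec using (Vec; []; _∷_; lookup; toList)
open import Data.Vec.Properties using (lookup-map)
open import Data.Vec.Relation.Unary.All using ([]; _∷_)
open import Data.Vec.Relation.Unary.All.Properties using (lookup⁺)
open import Function.Base using (_∘_)
open import Level using (_⊔_)
open import Relation.Binary.PropositionalEquality
  using (_≡_; _≢_; refl; sym; cong; cong₂; subst; isEquivalence)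
import Relation.Binary.PropositionalEquality as ≡
open import Relation.Nullary using (¬_; yes; no)
open Membership _≟_ using (_∈?_)

-- The three-element Sugihara monoid.

-- The elements stand for the upward closed subsets {}, {t} and {f, t} of {f, t},
-- f < t, in the phase model over ({f, t}, ∧, t).
data Truth : Set where
  ⊖ ⊙ ⊕ : Truth

infix  4 _≤_
infixr 7 _∙_
infixr 6 _⇒_

data _≤_ : Truth → Truth → Set where
  minimum : ∀ {a} → ⊖ ≤ a
  middle  : ⊙ ≤ ⊙
  maximum : ∀ {a} → a ≤ ⊕

_∙_ : Truth → Truth → Truth
⊙ ∙ b = b
⊖ ∙ b = ⊖
⊕ ∙ ⊖ = ⊖
⊕ ∙ ⊙ = ⊕
⊕ ∙ ⊕ = ⊕

_⇒_ : Truth → Truth → Truth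
⊙ ⇒ b = b
⊖ ⇒ b = ⊕
⊕ ⇒ ⊕ = ⊕
⊕ ⇒ ⊙ = ⊖
⊕ ⇒ ⊖ = ⊖

≤-refl : ∀ {a} → a ≤ a
≤-refl {⊖} = minimum
≤-refl {⊙} = middle
≤-refl {⊕} = maximum

≤-trans : ∀ {a b c} → a ≤ b → b ≤ c → a ≤ c
≤-trans minimum q       = minimum
≤-trans middle  q       = q
≤-trans maximum maximum = maximum

∙-assoc : Associative _≡_ _∙_
∙-assoc ⊖ b c = refl
∙-assoc ⊙ b c = refl
∙-assoc ⊕ ⊖ c = refl
∙-assoc ⊕ ⊙ c = refl
∙-assoc ⊕ ⊕ ⊖ = refl
∙-assoc ⊕ ⊕ ⊙ = refl
∙-assoc ⊕ ⊕ ⊕ = refl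

∙-comm : Commutative _≡_ _∙_
∙-comm ⊖ ⊖ = refl
∙-comm ⊖ ⊙ = refl
∙-comm ⊖ ⊕ = refl
∙-comm ⊙ ⊖ = refl
∙-comm ⊙ ⊙ = refl
∙-comm ⊙ ⊕ = refl
∙-comm ⊕ ⊖ = refl
∙-comm ⊕ ⊙ = refl
∙-comm ⊕ ⊕ = refl

∙-idem : Idempotent _≡_ _∙_
∙-idem ⊖ = refl
∙-idem ⊙ = refl
∙-idem ⊕ = refl

∙-identityʳ : ∀ a → a ∙ ⊙ ≡ a
∙-identityʳ a = ∙-comm a ⊙

∙-idempotentCommutativeMonoid : IdempotentCommutativeMonoid _ _
∙-idempotentCommutativeMonoid = record
  { isIdempotentCommutativeMonoid = record
    { isCommutativeMonoid = record
      { isMonoid = record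
        { isSemigroup = record
          { isMagma = record { isEquivalence = isEquivalence ; ∙-cong = cong₂ _∙_ }
          ; assoc   = ∙-assoc
          }
        ; identity = (λ _ → refl) , ∙-identityʳ
        }
      ; comm = ∙-comm
      }
    ; idem = ∙-idem
    }
  }

open Sum (IdempotentCommutativeMonoid.commutativeMonoid ∙-idempotentCommutativeMonoid)
  using () renaming (sum to ⨀; sum-cong-≗ to ⨀-cong; ∑-comm to ⨀-swap)
open Solver ∙-idempotentCommutativeMonoid using (solve; _⊜_) renaming (_⊕_ to _⊡_; id to ε)

∙-monoʳ-≤ : ∀ a {b c} → b ≤ c → a ∙ b ≤ a ∙ c
∙-monoʳ-≤ ⊖ _             = minimum
∙-monoʳ-≤ ⊙ b≤c           = b≤c
∙-monoʳ-≤ ⊕ minimum       = minimum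
∙-monoʳ-≤ ⊕ middle        = maximum
∙-monoʳ-≤ ⊕ (maximum {a}) = maximum

∙-mono-≤ : ∀ {a b c d} → a ≤ b → c ≤ d → a ∙ c ≤ b ∙ d
∙-mono-≤ {a} {b} {c} {d} a≤b c≤d =
  ≤-trans (∙-monoʳ-≤ a c≤d) (≡.subst₂ _≤_ (∙-comm d a) (∙-comm d b) (∙-monoʳ-≤ d a≤b))

⇒-intro : ∀ a {b c} → a ∙ b ≤ c → b ≤ a ⇒ c
⇒-intro ⊖ _ = maximum
⇒-intro ⊙ p = p
⇒-intro ⊕ {⊖} _ = minimum
⇒-intro ⊕ {⊙} maximum = maximum
⇒-intro ⊕ {⊕} maximum = maximum

⇒-elim : ∀ a {c} → a ∙ (a ⇒ c) ≤ c
⇒-elim ⊖     = minimum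
⇒-elim ⊙     = ≤-refl
⇒-elim ⊕ {⊖} = minimum
⇒-elim ⊕ {⊙} = minimum
⇒-elim ⊕ {⊕} = maximum

-- A product or residual with an argument other than `⊙` is `⊖` or `⊕`, so arguments never cancel to
-- `⊙`. This is why the value `⊙` detects the absence of a name.
∙-conicalˡ : ∀ {a b} → a ∙ b ≡ ⊙ → a ≡ ⊙
∙-conicalˡ {⊙}     _ = refl
∙-conicalˡ {⊕} {⊖} ()
∙-conicalˡ {⊕} {⊙} ()
∙-conicalˡ {⊕} {⊕} ()

∙-conicalʳ : ∀ {a b} → a ∙ b ≡ ⊙ → b ≡ ⊙
∙-conicalʳ {a} {b} p = ∙-conicalˡ (≡.trans (∙-comm b a) p)

⇒-conicalˡ : ∀ {a b} → a ⇒ b ≡ ⊙ → a ≡ ⊙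
⇒-conicalˡ {⊙}     _ = refl
⇒-conicalˡ {⊕} {⊖} ()
⇒-conicalˡ {⊕} {⊙} ()
⇒-conicalˡ {⊕} {⊕} ()

⇒-conicalʳ : ∀ {a b} → a ⇒ b ≡ ⊙ → b ≡ ⊙
⇒-conicalʳ {⊙}     p = p
⇒-conicalʳ {⊕} {⊖} ()
⇒-conicalʳ {⊕} {⊙} ()
⇒-conicalʳ {⊕} {⊕} ()

-- Multiplication by `⊕` changes only `⊙`, raising it to `⊕`. The inequality can thus be lost only
-- at `⊙ ≤ ⊙`.
⊕∙-≤ : ∀ {a b} → a ≤ b → ¬ (a ≡ ⊙ × b ≡ ⊙) → ⊕ ∙ a ≤ b
⊕∙-≤ minimum _ = minimum
⊕∙-≤ middle  p = ⊥-elim (p (refl , refl))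
⊕∙-≤ maximum _ = maximum

-- Finite products in the monoid.

⨀-≤⊙ : ∀ {n} (f : Fin n → Truth) → (∀ i → f i ≤ ⊙) → ⨀ f ≤ ⊙
⨀-≤⊙ {zero}  f p = middle
⨀-≤⊙ {suc n} f p = ∙-mono-≤ (p zero) (⨀-≤⊙ (f ∘ suc) (p ∘ suc))

⨀-mono-≤ : ∀ {n} {f g : Fin n → Truth} → (∀ i → f i ≤ g i) → ⨀ f ≤ ⨀ g
⨀-mono-≤ {zero}  p = middle
⨀-mono-≤ {suc n} p = ∙-mono-≤ (p zero) (⨀-mono-≤ (p ∘ suc))

-- Factors below the unit can be discarded; this is the weakening built into `i-var`.
⨀-≤-lookup : ∀ {n} (f : Fin n → Truth) x → (∀ y → y ≢ x → f y ≤ ⊙) → ⨀ f ≤ f x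
⨀-≤-lookup f zero p =
  subst (⨀ f ≤_) (∙-identityʳ (f zero)) (∙-monoʳ-≤ (f zero) (⨀-≤⊙ (f ∘ suc) λ y → p (suc y) λ ()))
⨀-≤-lookup f (suc x) p =
  ∙-mono-≤ (p zero λ ()) (⨀-≤-lookup (f ∘ suc) x λ y y≢x → p (suc y) (y≢x ∘ suc-injective))

-- Idempotence copies `a` to any positive number of factors; `a ≤ ⊙` settles the empty product, as
-- for `i-bang` without premises.
≤⊙⇒≤⨀ : ∀ {n a} {f : Fin n → Truth} → a ≤ ⊙ → (∀ i → f i ≡ a) → a ≤ ⨀ f
≤⊙⇒≤⨀ {zero}      a≤⊙ p = a≤⊙
≤⊙⇒≤⨀ {suc n} {a} a≤⊙ p =
  subst (_≤ _) (∙-idem a)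
    (∙-mono-≤ (subst (a ≤_) (sym (p zero)) ≤-refl) (≤⊙⇒≤⨀ a≤⊙ (p ∘ suc)))

-- Duplicate-free concatenations of lists.

Unique-++⁻ : ∀ {a} {A : Set a} (xs : List A) {ys} →
  Unique (xs ++ ys) → Unique xs × Unique ys × Disjoint xs ys
Unique-++⁻ []       u = [] , u , λ ()
Unique-++⁻ (x ∷ xs) (x∉ ∷ u) with Unique-++⁻ xs u
... | uxs , uys , d = (Allᴸ.++⁻ˡ xs x∉ ∷ uxs) , uys , λ
  { (here refl , q) → lookupᴬ (Allᴸ.++⁻ʳ xs x∉) q refl
  ; (there p , q)   → d (p , q) }

All-lookup⁻ : ∀ {a p} {A : Set a} {P : A → Set p} {xs} → (∀ i → P (List.lookup xs i)) → Allᴸ P xs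
All-lookup⁻ {xs = []}    p = []ᴸ
All-lookup⁻ {xs = _ ∷ _} p = p zero ∷ᴸ All-lookup⁻ (p ∘ suc)

module _ {a b} {A : Set a} {B : Set b} (f : A → List B) where

  Unique-concatMap⁻ : ∀ xs → Unique (concatMap f xs) → ∀ i → Unique (f (List.lookup xs i))
  Unique-concatMap⁻ (x ∷ xs) u zero    = proj₁ (Unique-++⁻ (f x) u)
  Unique-concatMap⁻ (x ∷ xs) u (suc i) = Unique-concatMap⁻ xs (proj₁ (proj₂ (Unique-++⁻ (f x) u))) i

  lookup⊆concatMap : ∀ xs i {z} → z ∈ f (List.lookup xs i) → z ∈ concatMap f xs
  lookup⊆concatMap (x ∷ xs) zero    p = ∈-++⁺ˡ p
  lookup⊆concatMap (x ∷ xs) (suc i) p = ∈-++⁺ʳ (f x) (lookup⊆concatMap xs i p)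

  concatMap⊆lookup : ∀ xs {z} → z ∈ concatMap f xs → ∃ λ i → z ∈ f (List.lookup xs i)
  concatMap⊆lookup xs p = let q = ∈-concatMap⁻ f {xs = xs} p in index q , lookup-index q

  Unique-concatMap⇒disjoint : ∀ xs → Unique (concatMap f xs) →
    ∀ i j → i ≢ j → Disjoint (f (List.lookup xs i)) (f (List.lookup xs j))
  Unique-concatMap⇒disjoint (x ∷ xs) u zero    zero    i≢j _ = i≢j refl
  Unique-concatMap⇒disjoint (x ∷ xs) u zero    (suc j) i≢j (p , q) =
    proj₂ (proj₂ (Unique-++⁻ (f x) u)) (p , lookup⊆concatMap xs j q)
  Unique-concatMap⇒disjoint (x ∷ xs) u (suc i) zero    i≢j (p , q) =
    proj₂ (proj₂ (Unique-++⁻ (f x) u)) (q , lookup⊆concatMap xs i p)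
  Unique-concatMap⇒disjoint (x ∷ xs) u (suc i) (suc j) i≢j =
    Unique-concatMap⇒disjoint xs (proj₁ (proj₂ (Unique-++⁻ (f x) u))) i j (i≢j ∘ cong suc)

-- Interpretation of types and contexts for a fixed name.

module Interpretation (Z : Name) where

  ⟦_⟧ᴳ : Ground → Truth
  ⟦ name X ⟧ᴳ with X ≟ Z
  ... | yes _ = ⊖
  ... | no  _ = ⊙
  ⟦ K ⊗ L ⟧ᴳ = ⟦ K ⟧ᴳ ∙ ⟦ L ⟧ᴳ

  ⟦_⟧  : Ty → Truth
  ⟦_⟧ˢ : List Ty → Truth

  ⟦_⟧ᴾ : Pos → Truth
  ⟦ gnd L ⟧ᴾ   = ⟦ L ⟧ᴳ
  ⟦ mset As ⟧ᴾ = ⟦ As ⟧ˢ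

  ⟦ pos P ⟧ = ⟦ P ⟧ᴾ
  ⟦ P ⊸ A ⟧ = ⟦ P ⟧ᴾ ⇒ ⟦ A ⟧

  ⟦ [] ⟧ˢ     = ⊙
  ⟦ A ∷ As ⟧ˢ = ⟦ A ⟧ ∙ ⟦ As ⟧ˢ

  ⟦_⟧ᶜ : ∀ {m} → Ctx m → Truth
  ⟦ Θ ⟧ᶜ = ⨀ λ x → ⟦ lookup Θ x ⟧ᴾ

  ∉⇒⊙ᴳ : ∀ L → Z ∉ nmGround L → ⟦ L ⟧ᴳ ≡ ⊙
  ∉⇒⊙ᴳ (name X) Z∉ with X ≟ Z
  ... | yes X≡Z = ⊥-elim (Z∉ (here (sym X≡Z)))
  ... | no  _   = refl
  ∉⇒⊙ᴳ (K ⊗ L) Z∉ = cong₂ _∙_ (∉⇒⊙ᴳ K (Z∉ ∘ ∈-++⁺ˡ)) (∉⇒⊙ᴳ L (Z∉ ∘ ∈-++⁺ʳ (nmGround K)))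

  ∉⇒⊙  : ∀ A → Z ∉ nmTy A → ⟦ A ⟧ ≡ ⊙
  ∉⇒⊙ˢ : ∀ As → Z ∉ nmTys As → ⟦ As ⟧ˢ ≡ ⊙

  ∉⇒⊙ᴾ : ∀ P → Z ∉ nmPos P → ⟦ P ⟧ᴾ ≡ ⊙
  ∉⇒⊙ᴾ (gnd L)   = ∉⇒⊙ᴳ L
  ∉⇒⊙ᴾ (mset As) = ∉⇒⊙ˢ As

  ∉⇒⊙ (pos P) = ∉⇒⊙ᴾ P
  ∉⇒⊙ (P ⊸ A) Z∉ = cong₂ _⇒_ (∉⇒⊙ᴾ P (Z∉ ∘ ∈-++⁺ˡ)) (∉⇒⊙ A (Z∉ ∘ ∈-++⁺ʳ (nmPos P)))

  ∉⇒⊙ˢ []       _  = refl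
  ∉⇒⊙ˢ (A ∷ As) Z∉ = cong₂ _∙_ (∉⇒⊙ A (Z∉ ∘ ∈-++⁺ˡ)) (∉⇒⊙ˢ As (Z∉ ∘ ∈-++⁺ʳ (nmTy A)))

  ∉⇒⊙ᶜ : ∀ {m} (Θ : Ctx m) → Z ∉ nmCtx Θ → ⟦ Θ ⟧ᶜ ≡ ⊙
  ∉⇒⊙ᶜ []      _  = refl
  ∉⇒⊙ᶜ (P ∷ Θ) Z∉ = cong₂ _∙_ (∉⇒⊙ᴾ P (Z∉ ∘ ∈-++⁺ˡ)) (∉⇒⊙ᶜ Θ (Z∉ ∘ ∈-++⁺ʳ (nmPos P)))

  ⊙⇒∉ᴳ : ∀ L → ⟦ L ⟧ᴳ ≡ ⊙ → Z ∉ nmGround L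
  ⊙⇒∉ᴳ (name X) e Z∈ with X ≟ Z
  ⊙⇒∉ᴳ (name X) () _           | yes _
  ⊙⇒∉ᴳ (name X) _  (here Z≡X) | no X≢Z = X≢Z (sym Z≡X)
  ⊙⇒∉ᴳ (K ⊗ L) e = [ ⊙⇒∉ᴳ K (∙-conicalˡ e) , ⊙⇒∉ᴳ L (∙-conicalʳ e) ] ∘ ∈-++⁻ (nmGround K)

  ⊙⇒∉  : ∀ A → ⟦ A ⟧ ≡ ⊙ → Z ∉ nmTy A
  ⊙⇒∉ˢ : ∀ As → ⟦ As ⟧ˢ ≡ ⊙ → Z ∉ nmTys As

  ⊙⇒∉ᴾ : ∀ P → ⟦ P ⟧ᴾ ≡ ⊙ → Z ∉ nmPos P
  ⊙⇒∉ᴾ (gnd L)   = ⊙⇒∉ᴳ L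
  ⊙⇒∉ᴾ (mset As) = ⊙⇒∉ˢ As

  ⊙⇒∉ (pos P) = ⊙⇒∉ᴾ P
  ⊙⇒∉ (P ⊸ A) e = [ ⊙⇒∉ᴾ P (⇒-conicalˡ e) , ⊙⇒∉ A (⇒-conicalʳ e) ] ∘ ∈-++⁻ (nmPos P)

  ⊙⇒∉ˢ []       _ = λ ()
  ⊙⇒∉ˢ (A ∷ As) e = [ ⊙⇒∉ A (∙-conicalˡ e) , ⊙⇒∉ˢ As (∙-conicalʳ e) ] ∘ ∈-++⁻ (nmTy A)

  ⊙⇒∉ᶜ : ∀ {m} (Θ : Ctx m) → ⟦ Θ ⟧ᶜ ≡ ⊙ → Z ∉ nmCtx Θ
  ⊙⇒∉ᶜ []      _ = λ ()
  ⊙⇒∉ᶜ (P ∷ Θ) e = [ ⊙⇒∉ᴾ P (∙-conicalˡ e) , ⊙⇒∉ᶜ Θ (∙-conicalʳ e) ] ∘ ∈-++⁻ (nmPos P)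

  -- Ground types are products of `⊖` and `⊙`; a `⊕` can arise only through `⊸`. Hence the ground
  -- part of a context can be discarded as well as copied.
  ≤⊙ᴳ : ∀ L → ⟦ L ⟧ᴳ ≤ ⊙
  ≤⊙ᴳ (name X) with X ≟ Z
  ... | yes _ = minimum
  ... | no  _ = middle
  ≤⊙ᴳ (K ⊗ L) = ∙-mono-≤ (≤⊙ᴳ K) (≤⊙ᴳ L)

  ≤⊙ᴾ : ∀ {P} → GroundOrEmpty P → ⟦ P ⟧ᴾ ≤ ⊙
  ≤⊙ᴾ (gnd {L}) = ≤⊙ᴳ L
  ≤⊙ᴾ empty     = middle

  ≤⊙ᶜ : ∀ {m} {Λ : Ctx m} → IsGround Λ → ⟦ Λ ⟧ᶜ ≤ ⊙
  ≤⊙ᶜ {Λ = Λ} g = ⨀-≤⊙ _ λ x → ≤⊙ᴾ (lookup⁺ g x)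

  ⟦⟧-resp-≅ : ∀ {A B} → A ≅ B → ⟦ A ⟧ ≡ ⟦ B ⟧
  ⟦⟧-resp-↭ : ∀ {As Bs} → Permutation _≅_ As Bs → ⟦ As ⟧ˢ ≡ ⟦ Bs ⟧ˢ
  ⟦⟧-resp-≋ : ∀ {As Bs} → Pointwise _≅_ As Bs → ⟦ As ⟧ˢ ≡ ⟦ Bs ⟧ˢ

  ⟦⟧-resp-≅ᵖ : ∀ {P Q} → P ≅ᵖ Q → ⟦ P ⟧ᴾ ≡ ⟦ Q ⟧ᴾ
  ⟦⟧-resp-≅ᵖ gnd      = refl
  ⟦⟧-resp-≅ᵖ (mset p) = ⟦⟧-resp-↭ p

  ⟦⟧-resp-≅ (pos p) = ⟦⟧-resp-≅ᵖ p
  ⟦⟧-resp-≅ (p ⊸ q) = cong₂ _⇒_ (⟦⟧-resp-≅ᵖ p) (⟦⟧-resp-≅ q)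

  ⟦⟧-resp-≋ []       = refl
  ⟦⟧-resp-≋ (p ∷ ps) = cong₂ _∙_ (⟦⟧-resp-≅ p) (⟦⟧-resp-≋ ps)

  ⟦⟧-resp-↭ (refl ps)   = ⟦⟧-resp-≋ ps
  ⟦⟧-resp-↭ (prep p ps) = cong₂ _∙_ (⟦⟧-resp-≅ p) (⟦⟧-resp-↭ ps)
  ⟦⟧-resp-↭ (swap {ys = ys} {x = A} {y = B} {x′ = A′} {y′ = B′} p q ps) =
    ≡.trans (cong₂ _∙_ (⟦⟧-resp-≅ p) (cong₂ _∙_ (⟦⟧-resp-≅ q) (⟦⟧-resp-↭ ps)))
      (solve 3 (λ a b c → a ⊡ b ⊡ c ⊜ b ⊡ a ⊡ c) refl ⟦ A′ ⟧ ⟦ B′ ⟧ ⟦ ys ⟧ˢ)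
  ⟦⟧-resp-↭ (trans p q) = ≡.trans (⟦⟧-resp-↭ p) (⟦⟧-resp-↭ q)

  ⟦++⟧ : ∀ As {Bs} → ⟦ As ++ Bs ⟧ˢ ≡ ⟦ As ⟧ˢ ∙ ⟦ Bs ⟧ˢ
  ⟦++⟧ []       = refl
  ⟦++⟧ (A ∷ As) = ≡.trans (cong (⟦ A ⟧ ∙_) (⟦++⟧ As)) (sym (∙-assoc ⟦ A ⟧ _ _))

  ⟦concat⟧ : ∀ {n} (Ass : Vec (List Ty) n) →
    ⟦ concat (toList Ass) ⟧ˢ ≡ ⨀ λ i → ⟦ lookup (Vec.map mset Ass) i ⟧ᴾ
  ⟦concat⟧ []         = refl
  ⟦concat⟧ (As ∷ Ass) = ≡.trans (⟦++⟧ As) (cong (⟦ As ⟧ˢ ∙_) (⟦concat⟧ Ass))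

  ⟦toList⟧ : ∀ {n} (As : Vec Ty n) → ⟦ toList As ⟧ˢ ≡ ⨀ λ i → ⟦ lookup As i ⟧
  ⟦toList⟧ []       = refl
  ⟦toList⟧ (A ∷ As) = cong (⟦ A ⟧ ∙_) (⟦toList⟧ As)

  -- Idempotence of ∙ is what allows the ground part to be shared.
  ⟦⨄⟧ᴾ : ∀ {n P} {Ps : Vec Pos n} → P ≅⨄ᵖ Ps → ⟦ P ⟧ᴾ ≤ ⨀ λ i → ⟦ lookup Ps i ⟧ᴾ
  ⟦⨄⟧ᴾ (gnd {L} ps)      = ≤⊙⇒≤⨀ (≤⊙ᴳ L) λ i → cong ⟦_⟧ᴾ (lookup⁺ ps i)
  ⟦⨄⟧ᴾ (mset Ass refl p) = subst (_ ≤_) (≡.trans (⟦⟧-resp-↭ p) (⟦concat⟧ Ass)) ≤-refl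

  -- The bounds for single variables give a product over variables of products over premises;
  -- exchanging the two leaves one factor per premise.
  ⟦⨄⟧ᶜ : ∀ {m n} (Θ : Ctx m) (Θs : Vec (Ctx m) n) → Θ ≅⨄ Θs → ⟦ Θ ⟧ᶜ ≤ ⨀ λ i → ⟦ lookup Θs i ⟧ᶜ
  ⟦⨄⟧ᶜ {m} {n} Θ Θs p =
    subst (⟦ Θ ⟧ᶜ ≤_) (⨀-swap {m} {n} λ x i → ⟦ lookup (lookup Θs i) x ⟧ᴾ)
      (⨀-mono-≤ λ x → subst (_ ≤_)
        (⨀-cong {n} λ i → cong ⟦_⟧ᴾ (lookup-map i (λ Θ′ → lookup Θ′ x) Θs)) (⟦⨄⟧ᴾ (p x)))

  -- Ground entries are squared and absorbed by idempotence; multiset entries meet only the unit.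
  -- This serves `i-letp`, whose value sees just the ground part.
  ⟦groundPart⟧ : ∀ {m} (Θ : Ctx m) → ⟦ groundPart Θ ⟧ᶜ ∙ ⟦ Θ ⟧ᶜ ≡ ⟦ Θ ⟧ᶜ
  ⟦groundPart⟧ []             = refl
  ⟦groundPart⟧ (gnd L ∷ Θ)   =
    ≡.trans (solve 3 (λ l g t → (l ⊡ g) ⊡ l ⊡ t ⊜ l ⊡ g ⊡ t) refl ⟦ L ⟧ᴳ ⟦ groundPart Θ ⟧ᶜ ⟦ Θ ⟧ᶜ)
      (cong (⟦ L ⟧ᴳ ∙_) (⟦groundPart⟧ Θ))
  ⟦groundPart⟧ (mset As ∷ Θ) =
    ≡.trans (solve 3 (λ a g t → g ⊡ a ⊡ t ⊜ a ⊡ g ⊡ t) refl ⟦ As ⟧ˢ ⟦ groundPart Θ ⟧ᶜ ⟦ Θ ⟧ᶜ)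
      (cong (⟦ As ⟧ˢ ∙_) (⟦groundPart⟧ Θ))

-- Induction on derivation trees and the names in them.

module _ {c ℓ₁ ℓ₂} (R : OrderedRing c ℓ₁ ℓ₂) where

  open Calculus R

  subtree : ∀ {J} (π : Tree J) (i : Fin (length (premises π))) →
    Tree (proj₁ (List.lookup (premises π) i))
  subtree π i = proj₂ (List.lookup (premises π) i)

  -- Induction hypotheses are indexed by positions in `premises π`, so that later arguments treat
  -- all rules alike; `inds` splits on the rule to keep the recursion structural.
  Tree-ind : ∀ {p} (P : ∀ {J} → Tree J → Set p) →
    (∀ {J} (π : Tree J) → (∀ i → P (subtree π i)) → P π) → ∀ {J} (π : Tree J) → P π
  Tree-ind P step = ind
    where
    ind : ∀ {J} (π : Tree J) → P π
    inds : ∀ {J} (π : Tree J) → Allᴸ (P ∘ proj₂) (premises π)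
    lookupᴸ : ∀ {πs : List (∃ Tree)} → Allᴸ (P ∘ proj₂) πs → ∀ i → P (proj₂ (List.lookup πs i))

    lookupᴸ (p ∷ᴸ ps) zero    = p
    lookupᴸ (p ∷ᴸ ps) (suc i) = lookupᴸ ps i

    ind π = step π (lookupᴸ (inds π))

    inds (i-sample _ _)         = []ᴸ
    inds (i-cond _ _ _ _ _ _ _) = []ᴸ
    inds (i-var _ _)            = []ᴸ
    inds (i-let _ π ρ)          = ind π ∷ᴸ ind ρ ∷ᴸ []ᴸ
    inds (i-pair _ π ρ)         = ind π ∷ᴸ ind ρ ∷ᴸ []ᴸ
    inds (i-letp π ρ)           = ind π ∷ᴸ ind ρ ∷ᴸ []ᴸ
    inds (i-abs π)              = ind π ∷ᴸ []ᴸ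
    inds (i-app _ π ρ)          = ind π ∷ᴸ ind ρ ∷ᴸ []ᴸ
    inds (i-bang _ _ _ πs)      = Allᴸ.tabulate⁺ (λ i → ind (πs i))
    inds (i-der π)              = ind π ∷ᴸ []ᴸ

  -- Gives every rule the same shape, so that uniqueness of one concatenation yields disjoint main
  -- names across premises.
  collectPremises≡concatMap : ∀ (f : ∀ {J} → Tree J → List Name) {J} (π : Tree J) →
    collectPremises f π ≡ concatMap (collect f ∘ proj₂) (premises π)
  collectPremises≡concatMap f (i-sample _ _)         = refl
  collectPremises≡concatMap f (i-cond _ _ _ _ _ _ _) = refl
  collectPremises≡concatMap f (i-var _ _)            = refl
  collectPremises≡concatMap f (i-let _ π ρ)          = cong (collect f π ++_) (sym (++-identityʳ _))
  collectPremises≡concatMap f (i-pair _ π ρ)         = cong (collect f π ++_) (sym (++-identityʳ _))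
  collectPremises≡concatMap f (i-letp π ρ)           = cong (collect f π ++_) (sym (++-identityʳ _))
  collectPremises≡concatMap f (i-abs π)              = sym (++-identityʳ _)
  collectPremises≡concatMap f (i-app _ π ρ)          = cong (collect f π ++_) (sym (++-identityʳ _))
  collectPremises≡concatMap f (i-bang _ _ _ πs)      =
    cong concat (sym (map-tabulate (λ i → _ , πs i) (collect f ∘ proj₂)))
  collectPremises≡concatMap f (i-der π)              = sym (++-identityʳ _)

  subtree⊆collectPremises : ∀ {J} (π : Tree J) i {z} →
    z ∈ mainNames (subtree π i) → z ∈ collectPremises mainName π
  subtree⊆collectPremises π i z∈ = subst (_ ∈_) (sym (collectPremises≡concatMap mainName π))
    (lookup⊆concatMap (mainNames ∘ proj₂) (premises π) i z∈)

  subtree-mainNames⊆ : ∀ {J} (π : Tree J) i {z} → z ∈ mainNames (subtree π i) → z ∈ mainNames π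
  subtree-mainNames⊆ π i z∈ = ∈-++⁺ʳ (mainName π) (subtree⊆collectPremises π i z∈)

  premises-mainNames-unique : ∀ {J} (π : Tree J) → Unique (mainNames π) →
    Unique (concatMap (mainNames ∘ proj₂) (premises π))
  premises-mainNames-unique π u =
    subst Unique (collectPremises≡concatMap mainName π) (proj₁ (proj₂ (Unique-++⁻ (mainName π) u)))

  nmTree⁻ : ∀ {J} (π : Tree J) {z} → z ∈ nmTree π →
    z ∈ nmJudgment J ⊎ ∃ λ i → z ∈ nmTree (subtree π i)
  nmTree⁻ {J} π z∈ = map₂
    (concatMap⊆lookup (nmTree ∘ proj₂) (premises π) ∘ subst (_ ∈_) (collectPremises≡concatMap _ π))
    (∈-++⁻ (nmJudgment J) z∈)

  -- Names in the ground part of a context.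

  GroundFree : ∀ {m} → Name → Ctx m → Set
  GroundFree Z Θ = ∀ x {L} → lookup Θ x ≡ gnd L → Z ∉ nmGround L

  ∉⇒GroundFree : ∀ {m Z} (Θ : Ctx m) → Z ∉ nmCtx Θ → GroundFree Z Θ
  ∉⇒GroundFree (P ∷ Θ) Z∉ zero    refl = Z∉ ∘ ∈-++⁺ˡ
  ∉⇒GroundFree (P ∷ Θ) Z∉ (suc x) e    = ∉⇒GroundFree Θ (Z∉ ∘ ∈-++⁺ʳ (nmPos P)) x e

  ⨄-gnd : ∀ {n P L} {Ps : Vec Pos n} → P ≅⨄ᵖ Ps → P ≡ gnd L → ∀ i → lookup Ps i ≡ gnd L
  ⨄-gnd (gnd ps) refl = lookup⁺ ps

  GroundFree-⨄ : ∀ {m n Z} (Θ : Ctx m) (Θs : Vec (Ctx m) n) → Θ ≅⨄ Θs →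
    ∀ i → GroundFree Z (lookup Θs i) → GroundFree Z Θ
  GroundFree-⨄ Θ Θs Θ≅ i free x e = free x
    (≡.trans (sym (lookup-map i (λ Θ′ → lookup Θ′ x) Θs)) (⨄-gnd (Θ≅ x) e i))

  -- Multisets may be split among premises, whereas each ground entry of the conclusion recurs in
  -- every premise. Freedom in any one premise therefore passes down.
  GroundFree-premise : ∀ {J} (π : Tree J) {Z ρ} → ρ ∈ premises π →
    GroundFree Z (Judgment.context (proj₁ ρ)) → GroundFree Z (Judgment.context J)
  GroundFree-premise (i-let {Θ = Θ} {Θ₁} {Θ₂} Θ≅ π ρ) (here refl) free =
    GroundFree-⨄ Θ (Θ₁ ∷ Θ₂ ∷ []) Θ≅ zero free
  GroundFree-premise (i-let {Θ = Θ} {Θ₁} {Θ₂} Θ≅ π ρ) (there (here refl)) free =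
    GroundFree-⨄ Θ (Θ₁ ∷ Θ₂ ∷ []) Θ≅ (suc zero) (free ∘ suc)
  GroundFree-premise (i-pair _ π ρ) (here refl) free = free
  GroundFree-premise (i-pair _ π ρ) (there (here refl)) free = free
  GroundFree-premise (i-letp {Θ = Θ} π ρ) (here refl) free x e =
    free x (≡.trans (lookup-map x groundPartᵖ Θ) (cong groundPartᵖ e))
  GroundFree-premise (i-letp π ρ) (there (here refl)) free = λ x → free (suc (suc x))
  GroundFree-premise (i-abs π) (here refl) free = free ∘ suc
  GroundFree-premise (i-app {Θ = Θ} {Θ₁} {Θ₂} Θ≅ π ρ) (here refl) free =
    GroundFree-⨄ Θ (Θ₁ ∷ Θ₂ ∷ []) Θ≅ zero free
  GroundFree-premise (i-app {Θ = Θ} {Θ₁} {Θ₂} Θ≅ π ρ) (there (here refl)) free =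
    GroundFree-⨄ Θ (Θ₁ ∷ Θ₂ ∷ []) Θ≅ (suc zero) free
  GroundFree-premise (i-bang {Θ = Θ} Θs _ Θ≅ πs) ρ∈ free with ∈-tabulate⁻ ρ∈
  ... | i , refl = GroundFree-⨄ Θ Θs Θ≅ i free
  GroundFree-premise (i-der π) (here refl) free = free

  -- Soundness of the typing rules.

  module Soundness (Z : Name) where

    open Interpretation Z

    -- The factor `⊙` gives ordinary soundness and `⊕` the strengthened inequality; an arbitrary
    -- factor lets one proof per rule serve both.
    Valid : Truth → Judgment → Set
    Valid f (Θ ⊢ _ ∶ A) = f ∙ ⟦ Θ ⟧ᶜ ≤ ⟦ A ⟧

    -- Factors of the premises are multiplied, so a single `⊕` among units makes the total `⊕`.
    data Valids : Truth → List (∃ Tree) → Set (c ⊔ ℓ₁ ⊔ ℓ₂) where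
      []  : Valids ⊙ []
      _∷_ : ∀ {f g ρ ρs} → Valid f (proj₁ ρ) → Valids g ρs → Valids (f ∙ g) (ρ ∷ ρs)

    Valids-tabulate⁻ : ∀ {n f} (ρ : Fin n → ∃ Tree) → Valids f (List.tabulate ρ) →
      f ∙ ⨀ (λ i → ⟦ Judgment.context (proj₁ (ρ i)) ⟧ᶜ) ≤ ⨀ λ i → ⟦ Judgment.type (proj₁ (ρ i)) ⟧
    Valids-tabulate⁻ {zero}  ρ []      = middle
    Valids-tabulate⁻ {suc n} ρ (_∷_ {f} {g} p ps) =
      subst (_≤ _) (solve 4 (λ f g a b → (f ⊡ a) ⊡ (g ⊡ b) ⊜ (f ⊡ g) ⊡ (a ⊡ b)) refl f g _ _)
        (∙-mono-≤ p (Valids-tabulate⁻ (ρ ∘ suc) ps))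

    ⊙-Valids : ∀ {ρs} → (∀ i → Valid ⊙ (proj₁ (List.lookup ρs i))) → Valids ⊙ ρs
    ⊙-Valids {[]}    p = []
    ⊙-Valids {_ ∷ _} p = p zero ∷ ⊙-Valids (p ∘ suc)

    ⊕-Valids : ∀ {ρs} i → Valid ⊕ (proj₁ (List.lookup ρs i)) →
      (∀ k → k ≢ i → Valid ⊙ (proj₁ (List.lookup ρs k))) → Valids ⊕ ρs
    ⊕-Valids {_ ∷ _} zero    p q = p ∷ ⊙-Valids λ k → q (suc k) λ ()
    ⊕-Valids {_ ∷ _} (suc i) p q =
      q zero (λ ()) ∷ ⊕-Valids i p λ k k≢i → q (suc k) (k≢i ∘ suc-injective)

    rule-sound : ∀ {J f} (π : Tree J) → Z ∉ mainName π → Valids f (premises π) → Valid f J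
    rule-sound (i-sample {X = X} g _) Z∉ [] =
      -- An axiom has the empty product `⊙` as factor, and its type is `⊙` because its main name is
      -- not `Z`.
      subst (_ ≤_) (sym (∉⇒⊙ᴳ (name X) Z∉)) (≤⊙ᶜ g)
    rule-sound (i-cond _ _ _ {X = X} g _ _ _) Z∉ [] =
      subst (_ ≤_) (sym (∉⇒⊙ᴳ (name X) Z∉)) (≤⊙ᶜ g)
    rule-sound (i-var {x = x} g p) _ [] =
      subst (_ ≤_) (⟦⟧-resp-≅ᵖ p) (⨀-≤-lookup _ x λ y y≢x → ≤⊙ᴾ (g y y≢x))
    rule-sound (i-let {Θ = Θ} {Θ₁} {Θ₂} {P = P} Θ≅ π ρ) _ (_∷_ {f} p (_∷_ {g} q [])) =
      ≤-trans (∙-monoʳ-≤ (f ∙ g ∙ ⊙) (⟦⨄⟧ᶜ Θ (Θ₁ ∷ Θ₂ ∷ []) Θ≅))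
        -- A cut: the first premise bounds the value of `P`, the type of the bound variable in the
        -- second.
        (≤-trans (subst (_≤ g ∙ ⟦ P ⟧ᴾ ∙ ⟦ Θ₂ ⟧ᶜ)
            (solve 4 (λ f g a b → g ⊡ ((f ⊡ a) ⊡ b) ⊜ (f ⊡ g ⊡ ε) ⊡ (a ⊡ b ⊡ ε)) refl
              f g ⟦ Θ₁ ⟧ᶜ ⟦ Θ₂ ⟧ᶜ)
            (∙-monoʳ-≤ g (∙-mono-≤ p ≤-refl)))
          q)
    rule-sound (i-pair {Λ = Λ} _ π ρ) _ (_∷_ {f} p (_∷_ {g} q [])) =
      -- Both premises use all of `Λ`; idempotence merges the two copies.
      subst (_≤ _) (solve 3 (λ f g a → (f ⊡ a) ⊡ (g ⊡ a) ⊜ (f ⊡ g ⊡ ε) ⊡ a) refl f g ⟦ Λ ⟧ᶜ)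
        (∙-mono-≤ p q)
    rule-sound (i-letp {Θ = Θ} {L₁ = L₁} {L₂} π ρ) _ (_∷_ {f} p (_∷_ {g} q [])) =
      subst (λ a → (f ∙ g ∙ ⊙) ∙ a ≤ _) (⟦groundPart⟧ Θ)
        (≤-trans (≡.subst₂ _≤_
            (solve 4 (λ f g a b → g ⊡ ((f ⊡ a) ⊡ b) ⊜ (f ⊡ g ⊡ ε) ⊡ (a ⊡ b)) refl
              f g ⟦ groundPart Θ ⟧ᶜ ⟦ Θ ⟧ᶜ)
            (solve 4 (λ g k l b → g ⊡ ((k ⊡ l) ⊡ b) ⊜ g ⊡ l ⊡ k ⊡ b) refl
              g ⟦ L₁ ⟧ᴳ ⟦ L₂ ⟧ᴳ ⟦ Θ ⟧ᶜ)
            (∙-monoʳ-≤ g (∙-mono-≤ p ≤-refl)))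
          q)
    rule-sound (i-abs {Θ = Θ} {P = P} π) _ (_∷_ {f} p []) =
      ⇒-intro ⟦ P ⟧ᴾ (subst (_≤ _)
        (solve 3 (λ f a b → f ⊡ a ⊡ b ⊜ a ⊡ ((f ⊡ ε) ⊡ b)) refl f ⟦ P ⟧ᴾ ⟦ Θ ⟧ᶜ) p)
    rule-sound (i-app {Θ = Θ} {Θ₁} {Θ₂} {P = P} Θ≅ π ρ) _ (_∷_ {f} p (_∷_ {g} q [])) =
      ≤-trans (∙-monoʳ-≤ (f ∙ g ∙ ⊙) (⟦⨄⟧ᶜ Θ (Θ₁ ∷ Θ₂ ∷ []) Θ≅))
        (≤-trans (subst (_≤ _)
            (solve 4 (λ f g a b → (g ⊡ b) ⊡ (f ⊡ a) ⊜ (f ⊡ g ⊡ ε) ⊡ (a ⊡ b ⊡ ε)) refl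
              f g ⟦ Θ₁ ⟧ᶜ ⟦ Θ₂ ⟧ᶜ)
            (∙-mono-≤ q p))
          (⇒-elim ⟦ P ⟧ᴾ))
    rule-sound {f = f} (i-bang {Θ = Θ} Θs As Θ≅ πs) _ ps =
      ≤-trans (∙-monoʳ-≤ f (⟦⨄⟧ᶜ Θ Θs Θ≅))
        (subst (_ ≤_) (sym (⟦toList⟧ As)) (Valids-tabulate⁻ (λ i → _ , πs i) ps))
    rule-sound (i-der {A = A} π) _ (_∷_ {f} p []) =
      ≡.subst₂ _≤_ (cong (_∙ _) (sym (∙-identityʳ f))) (∙-identityʳ ⟦ A ⟧) p

    -- An occurrence of `Z` keeps one side away from `⊙`, which removes the only obstruction to
    -- multiplying by `⊕`.
    ∈⇒⊕-Valid : ∀ J → Valid ⊙ J → Z ∈ nmJudgment J → Valid ⊕ J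
    ∈⇒⊕-Valid (Θ ⊢ _ ∶ A) p Z∈ =
      ⊕∙-≤ p λ (Θ⊙ , A⊙) → [ ⊙⇒∉ᶜ Θ Θ⊙ , ⊙⇒∉ A A⊙ ] (∈-++⁻ (nmCtx Θ) Z∈)

    ∉⇒⊙-Valid : ∀ J → Z ∉ nmJudgment J → Valid ⊙ J
    ∉⇒⊙-Valid (Θ ⊢ _ ∶ A) Z∉ =
      ≡.subst₂ _≤_ (sym (∉⇒⊙ᶜ Θ (Z∉ ∘ ∈-++⁺ˡ))) (sym (∉⇒⊙ A (Z∉ ∘ ∈-++⁺ʳ (nmCtx Θ)))) middle

    ∉⇒¬⊕-Valid : ∀ J → Z ∉ nmJudgment J → ¬ Valid ⊕ J
    ∉⇒¬⊕-Valid (Θ ⊢ _ ∶ A) Z∉ p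
      with ≡.subst₂ (λ a b → ⊕ ∙ a ≤ b) (∉⇒⊙ᶜ Θ (Z∉ ∘ ∈-++⁺ˡ)) (∉⇒⊙ A (Z∉ ∘ ∈-++⁺ʳ (nmCtx Θ))) p
    ... | ()

    GroundFree⇒⊙ : ∀ {m} (Λ : Ctx m) → IsGround Λ → GroundFree Z Λ → ⟦ Λ ⟧ᶜ ≡ ⊙
    GroundFree⇒⊙ []            _       _    = refl
    GroundFree⇒⊙ (gnd L ∷ Λ)   (_ ∷ g) free =
      cong₂ _∙_ (∉⇒⊙ᴳ L (free zero refl)) (GroundFree⇒⊙ Λ g (free ∘ suc))
    GroundFree⇒⊙ (mset [] ∷ Λ) (_ ∷ g) free = GroundFree⇒⊙ Λ g (free ∘ suc)

    sound : ∀ {J} (π : Tree J) → Z ∉ mainNames π → Valid ⊙ J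
    sound = Tree-ind (λ {J} π → Z ∉ mainNames π → Valid ⊙ J) λ π ih Z∉ →
      rule-sound π (Z∉ ∘ ∈-++⁺ˡ) (⊙-Valids λ i → ih i (Z∉ ∘ subtree-mainNames⊆ π i))

    -- If `Z` occurs in the conclusion, plain soundness is upgraded there; otherwise the `⊕` of a
    -- premise containing `Z` is carried down by the rule.
    ∈⇒sound : ∀ {J} (π : Tree J) → Z ∉ mainNames π → Z ∈ nmTree π → Valid ⊕ J
    ∈⇒sound = Tree-ind (λ {J} π → Z ∉ mainNames π → Z ∈ nmTree π → Valid ⊕ J) λ {J} π ih Z∉ Z∈ →
      [ ∈⇒⊕-Valid J (sound π Z∉)
      , (λ (i , Z∈i) → rule-sound π (Z∉ ∘ ∈-++⁺ˡ)
          (⊕-Valids i (ih i (Z∉ ∘ subtree-mainNames⊆ π i) Z∈i)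
            λ k _ → sound (subtree π k) (Z∉ ∘ subtree-mainNames⊆ π k)))
      ] (nmTree⁻ π Z∈)

    nmTree⇒mainNames : ∀ {J} (π : Tree J) → Z ∈ nmTree π → Z ∉ nmJudgment J → Z ∈ mainNames π
    nmTree⇒mainNames {J} π Z∈ Z∉ with Z ∈? mainNames π
    ... | yes Z∈main = Z∈main
    ... | no  Z∉main = ⊥-elim (∉⇒¬⊕-Valid J Z∉ (∈⇒sound π Z∉main Z∈))

  -- Sealed trees and well-formedness.

  open Soundness

  -- ⊕-validity of J would refute the conclusion of the derivation that contains π.
  Sealed : ∀ {J} → Tree J → Set
  Sealed {J} π = ∀ Z → Z ∈ mainNames π → GroundFree Z (Judgment.context J) → ¬ Valid Z ⊕ J

  -- Since `⟦ Λ ⟧ᶜ` is `⊙`, validity with `⊕` would read `⊕ ≤ ⟦ L ⟧ᴳ`, against `⟦ L ⟧ᴳ ≤ ⊙`.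
  ground-sealed : ∀ {m} {Λ : Ctx m} {t L} → IsGround Λ → (π : Tree (Λ ⊢ t ∶ pos (gnd L))) → Sealed π
  ground-sealed {Λ = Λ} {L = L} g π Z _ free p
    with ≤-trans (subst (λ a → ⊕ ∙ a ≤ _) (GroundFree⇒⊙ Z Λ g free) p) (Interpretation.≤⊙ᴳ Z L)
  ... | ()

  module _ {J} (π : Tree J) (u : Unique (mainNames π)) (sealed : Sealed π) where

    private
      disjoint : ∀ i j → i ≢ j → Disjoint (mainNames (subtree π i)) (mainNames (subtree π j))
      disjoint = Unique-concatMap⇒disjoint (mainNames ∘ proj₂) (premises π)
        (premises-mainNames-unique π u)

      main∉ : ∀ i {Z} → Z ∈ mainNames (subtree π i) → Z ∉ mainName π
      main∉ i {Z} Z∈ Z∈π = proj₂ (proj₂ (Unique-++⁻ (mainName π) u))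
        (Z∈π , subtree⊆collectPremises π i Z∈)

    -- A main name of premise `i` is main neither in the other premises nor at the root. So those
    -- premises are sound, and a `⊕` at premise `i` would reach the sealed conclusion.
    subtree-sealed : ∀ i → Sealed (subtree π i)
    subtree-sealed i Z Z∈ free p = sealed Z (subtree-mainNames⊆ π i Z∈)
      (GroundFree-premise π (∈-lookup i) free)
      (rule-sound Z π (main∉ i Z∈) (⊕-Valids Z i p λ k k≢i →
        sound Z (subtree π k) λ Z∈k → disjoint k i k≢i (Z∈k , Z∈)))

    -- Treating premise j as valid amounts to renaming Z in its derivation, which
    -- leaves the occurrence of Z in premise i without a source.
    premises-compatible : Compatible (premises π)
    premises-compatible Z j Z∈j Z∉j i i≢j Z∈i = sealed Z (subtree-mainNames⊆ π j Z∈main)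
      (GroundFree-premise π (∈-lookup j) (∉⇒GroundFree (Judgment.context Jⱼ) (Z∉j ∘ ∈-++⁺ˡ)))
      (rule-sound Z π (main∉ j Z∈main)
        (⊕-Valids Z i (∈⇒sound Z (subtree π i) (Z∉ i i≢j) Z∈i) valid))
      where
      Jⱼ : Judgment
      Jⱼ = proj₁ (List.lookup (premises π) j)
      Z∈main : Z ∈ mainNames (subtree π j)
      Z∈main = nmTree⇒mainNames Z (subtree π j) Z∈j Z∉j
      Z∉ : ∀ k → k ≢ j → Z ∉ mainNames (subtree π k)
      Z∉ k k≢j Z∈k = disjoint k j k≢j (Z∈k , Z∈main)
      valid : ∀ k → k ≢ i → Valid Z ⊙ (proj₁ (List.lookup (premises π) k))
      valid k _ with k ≟ᶠ j
      -- `sound` does not apply to premise `j`, where `Z` is a main name, but both sides of its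
      -- judgment are `⊙`.
      ... | yes refl = ∉⇒⊙-Valid Z Jⱼ Z∉j
      ... | no  k≢j  = sound Z (subtree π k) (Z∉ k k≢j)

  sealed⇒wellFormed : ∀ {J} (π : Tree J) → Unique (mainNames π) → Sealed π → WellFormedTree (J , π)
  sealed⇒wellFormed = Tree-ind (λ {J} π → Unique (mainNames π) → Sealed π → WellFormedTree (J , π))
    λ π ih u s → wf (premises-compatible π u s) (All-lookup⁻ λ i →
      ih i (Unique-concatMap⁻ (mainNames ∘ proj₂) (premises π) (premises-mainNames-unique π u) i)
        (subtree-sealed π u s i))

lemma6p6 : ∀ {c ℓ₁ ℓ₂} (R : OrderedRing c ℓ₁ ℓ₂) → let open Calculus R in
    ∀ {m} {Λ : Ctx m} {t : Tm m} {L : Ground} → IsGround Λ →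
    (π : Derivation (Λ ⊢ t ∶ pos (gnd L))) → WellFormed π
lemma6p6 R g π = sealed⇒wellFormed R tree naming (ground-sealed R g tree)
  where open Calculus.Derivation π
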